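{- For any $d \in \mathbb{N}$ and any graph class $\mathcal{C}$, the following are equivalent: (i) $\mathcal{C}$ has tree rank at most $d$; (ii) for every $r \in \mathbb{N}$ there exists $m \in \mathbb{N}$ such that every vertex of every graph in $\mathcal{C}$ has $(r,m)$-rank at most $d$.
   Context: Graphs are finite and simple. For a graph $G$ and vertex $v$, $N_r^G(v)$ is the closed $r$-neighborhood of $v$ (all vertices reachable from $v$ by a path with at most $r$ edges, including $v$); $G-S$ is the subgraph induced on $V(G)\setminus S$. The depth of a rooted tree is the number of edges on a leaf-to-root path; $T_{d,m}$ is the rooted tree of depth $d$ in which every non-leaf vertex has exactly $m$ children. A $\le r$-subdivision of a graph $H$ is obtained by replacing each edge $uv$ by a path from $u$ to $v$ with at most $r$ internal vertices (paths internally disjoint). $H$ is an $r$-shallow topological minor of $G$ if $G$ has a subgraph isomorphic to a $\le r$-subdivision of $H$. A graph class $\mathcal{C}$ has tree rank at most $d$ if for every $r\in\mathbb{N}$ there exists $m\in\mathbb{N}$ such that no $G\in\mathcal{C}$ contains $T_{d,m}$ as an $r$-shallow topological minor. The $(r,m)$-rank of vertices of $G$ (values in $\mathbb{N}\cup\{\infty\}$) is defined by the following procedure: initially every vertex has rank $\infty$; in rounds $i=1,2,3,\dots$, every vertex $v$ that currently has rank $\infty$ receives rank $i$ if there exists a set $S\subseteq V(G)\setminus\{v\}$ with $|S|\le m$ such that every vertex of $N_r^{G-S}(v)\setminus\{v\}$ received a finite rank in rounds $1,\dots,i-1$ (all vertices are checked simultaneously in a round); the procedure stops when all vertices have finite rank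 or a round assigns no new rank. Vertices still of rank $\infty$ keep rank $\infty$. -}

module Defs where

open import Data.Empty using (⊥)
open import Data.Fin.Base using (Fin)
open import Data.List.Base using (List; []; _∷_; _++_; [_]; length; head; last; reverse)
open import Data.List.Membership.Propositional using (_∈_; _∉_)
open import Data.List.Relation.Unary.Linked using (Linked)
open import Data.List.Relation.Unary.Unique.Propositional using (Unique)
open import Data.Maybe.Base using (just)
open import Data.Nat.Base using (ℕ; zero; suc; _≤_)
open import Data.Product.Base using (Σ; Σ-syntax; ∃-syntax; _×_; _,_; proj₁)
open import Data.Sum.Base using (_⊎_; inj₁; inj₂; swap)
open import Function.Bundles using (_↔_)
open import Function.Definitions using (Injective)
open import Level using (Level) renaming (zero to 0ℓ; suc to lsuc; _⊔_ to _⊔ˡ_)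
open import Relation.Binary.Core using (Rel)
open import Relation.Binary.Definitions using (Symmetric; Irreflexive; Decidable)
open import Relation.Binary.PropositionalEquality.Core using (_≡_; _≢_; refl)
open import Relation.Nullary.Negation.Core using (¬_)

record Graph : Set₁ where
  field
    V      : Set
    Adj    : Rel V 0ℓ
    sym    : Symmetric Adj
    irrefl : Irreflexive _≡_ Adj

open Graph using (V)

record FiniteGraph : Set₁ where
  field
    graph : Graph
    order : ℕ
    enum  : Fin order ↔ V graph
    adj?  : Decidable (Graph.Adj graph)

open FiniteGraph public using (graph)

GraphClass : (ℓ : Level) → Set (lsuc 0ℓ ⊔ˡ lsuc ℓ)
GraphClass ℓ = FiniteGraph → Set ℓ

Vertex : FiniteGraph → Set
Vertex G = V (graph G)

-- The list of all vertices along a path; its number of edges is one less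
-- than its length.
record IsPath (G : Graph) (u v : V G) (p : List (V G)) : Set where
  field
    starts : head p ≡ just u
    ends   : last p ≡ just v
    linked : Linked (Graph.Adj G) p
    unique : Unique p

-- x ∈ N_r^G(v)
InBall : (G : Graph) (r : ℕ) (v x : V G) → Set
InBall G r v x = ∃[ p ] (IsPath G v x p × length p ≤ suc r)

induced : (G : Graph) → (V G → Set) → Graph
induced G P = record
  { V      = Σ (V G) P
  ; Adj    = λ x y → Graph.Adj G (proj₁ x) (proj₁ y)
  ; sym    = Graph.sym G
  ; irrefl = λ { refl → Graph.irrefl G refl }
  }

-- Here a list stands for the set of its entries.
_−_ : (G : Graph) → List (V G) → Graph
G − S = induced G (_∉ S)

-- Nodes of T_{d,m}: words over Fin m of length at most d, read from the root.
data Node (m : ℕ) : ℕ → Set where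
  root  : ∀ {d} → Node m d
  below : ∀ {d} → Fin m → Node m d → Node m (suc d)

data IsParent {m : ℕ} : ∀ {d} → Node m d → Node m d → Set where
  here  : ∀ {d} (c : Fin m) → IsParent {d = suc d} root (below c root)
  there : ∀ {d} (c : Fin m) {u v : Node m d} → IsParent u v → IsParent (below c u) (below c v)

IsParent-irrefl : ∀ {m d} {u : Node m d} → ¬ IsParent u u
IsParent-irrefl (there _ e) = IsParent-irrefl e

T : (d m : ℕ) → Graph
T d m = record
  { V      = Node m d
  ; Adj    = λ u v → IsParent u v ⊎ IsParent v u
  ; sym    = swap
  ; irrefl = λ { refl (inj₁ e) → IsParent-irrefl e ; refl (inj₂ e) → IsParent-irrefl e }
  }

-- K is a ≤r-subdivision of H.  `inner u v` lists the internal vertices of the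
-- path replacing the edge uv, from u to v; it is unconstrained (and unused)
-- when uv is not an edge.
record IsSubdivision (r : ℕ) (H K : Graph) : Set where
  open Graph H using () renaming (Adj to _~_)
  field
    branch           : V H → V K
    branch-injective : Injective _≡_ _≡_ branch
    inner            : V H → V H → List (V K)

  path : V H → V H → List (V K)
  path u v = branch u ∷ inner u v ++ [ branch v ]

  field
    inner-length   : ∀ {u v} → u ~ v → length (inner u v) ≤ r
    inner-reverse  : ∀ {u v} → u ~ v → inner v u ≡ reverse (inner u v)
    path-isPath    : ∀ {u v} → u ~ v → IsPath K (branch u) (branch v) (path u v)
    inner-new      : ∀ {u v} → u ~ v → ∀ w → branch w ∉ inner u v
    inner-disjoint : ∀ {u v u′ v′ x} → u ~ v → u′ ~ v′ → x ∈ inner u v → x ∈ inner u′ v′ →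
                     (u ≡ u′ × v ≡ v′) ⊎ (u ≡ v′ × v ≡ u′)
    covers-V       : ∀ x → (∃[ w ] x ≡ branch w) ⊎ (∃[ u ] ∃[ v ] (u ~ v × x ∈ inner u v))
    covers-Adj     : ∀ {x y} → Graph.Adj K x y →
                     ∃[ u ] ∃[ v ] (u ~ v × ∃[ xs ] ∃[ ys ] path u v ≡ xs ++ x ∷ y ∷ ys)

-- G has a (not necessarily induced) subgraph isomorphic to K.
record _IsContainedIn_ (K G : Graph) : Set where
  field
    map           : V K → V G
    map-injective : Injective _≡_ _≡_ map
    map-Adj       : ∀ {x y} → Graph.Adj K x y → Graph.Adj G (map x) (map y)

ShallowTopologicalMinor : (r : ℕ) (H G : Graph) → Set₁
ShallowTopologicalMinor r H G = Σ[ K ∈ Graph ] (IsSubdivision r H K × K IsContainedIn G)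

TreeRankAtMost : ∀ {ℓ} → ℕ → GraphClass ℓ → Set (lsuc 0ℓ ⊔ˡ ℓ)
TreeRankAtMost d 𝒞 =
  ∀ r → ∃[ m ] (∀ G → 𝒞 G → ¬ ShallowTopologicalMinor r (T d m) (graph G))

module Rank (G : Graph) (r m : ℕ) where

  -- The sets of at most m vertices are those listed by a list of length at most m.
  Eligible : (V G → Set) → V G → Set
  Eligible Ranked v =
    ∃[ S ] Σ[ v∉S ∈ v ∉ S ]
      (length S ≤ m ×
       (∀ x → InBall (G − S) r (v , v∉S) x → x ≢ (v , v∉S) → Ranked (proj₁ x)))

  -- The stopping rule needs no counterpart: once a round assigns no rank,
  -- neither does any later one.
  mutual
    HasRank : ℕ → V G → Set
    HasRank zero    v = ⊥
    HasRank (suc i) v = ¬ RankedWithin i v × Eligible (RankedWithin i) v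

    -- v received a finite rank in one of the rounds 1, …, i.
    RankedWithin : ℕ → V G → Set
    RankedWithin zero    v = ⊥
    RankedWithin (suc i) v = RankedWithin i v ⊎ HasRank (suc i) v

  -- Rank ∞ is the absence of any i with HasRank i v.
  RankAtMost : ℕ → V G → Set
  RankAtMost d v = ∃[ i ] (i ≤ d × HasRank i v)

open Rank public using (RankAtMost)

{-# OPTIONS --safe #-}
module Submission where

-- If T_{d,m+1} is subdivided in G with at most r internal vertices per edge, the
-- root of every copy of T_{i,m+1} in it has (r+1,m)-rank above i: deleting m
-- vertices spares one of the m+1 disjoint paths to the children, and by induction
-- that child has rank above i-1.
--
-- Conversely, a vertex v of rank above i can, after deleting any m other vertices,
-- still reach within distance r some other vertex of rank above i-1.  Deleting
-- everything used so far, one grows a subdivided T_{i,n} at v child by child; the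
-- construction never runs out when m bounds the number of vertices it uses.
-- Ranks in finite graphs are decidable, so the contrapositive suffices.

open import Defs
open import Data.Bool.Base using (if_then_else_; true; false)
open import Data.Fin.Base using (Fin; zero; suc; _<_)
open import Data.Fin.Properties using (any?; pigeonhole; inj⇒≟; <⇒≢)
open import Data.List.Base using (List; []; _∷_; _++_; [_]; length; last; lookup; map; reverse)
open import Data.List.Membership.Propositional using (_∈_; _∉_; mapWith∈; find; lose)
open import Data.List.Membership.Setoid.Properties using (unique⇒irrelevant)
open import Data.List.Membership.Propositional.Properties
  using (∈-++⁺ˡ; ∈-++⁺ʳ; ∈-++⁻; ∈-map⁺; ∈-map⁻; map-mapWith∈; mapWith∈-id)
open import Data.List.Properties
  using (length-map; length-++; length-reverse; map-++; last-map; reverse-++;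
    reverse-involutive; ++-assoc; unfold-reverse)
open import Data.List.Relation.Unary.All as All using (All; []; _∷_)
open import Data.List.Relation.Unary.All.Properties using (¬Any⇒All¬; All¬⇒¬Any)
open import Data.List.Relation.Unary.AllPairs using ([]; _∷_; allPairs?)
open import Data.List.Relation.Unary.Any as Any using (Any; here; there)
open import Data.List.Relation.Unary.Any.Properties using (lookup-index; reverse⁻)
open import Data.List.Relation.Unary.Linked as Linked using (Linked; []; [-]; _∷_; linked?)
import Data.List.Relation.Unary.Linked.Properties as Linked
open import Data.List.Relation.Unary.Unique.Propositional using (Unique)
import Data.List.Relation.Unary.Unique.Propositional.Properties as Unique
open import Data.Maybe.Base as Maybe using (just)
open import Data.Maybe.Properties as Maybe using (just-injective)
open import Data.Nat.Base using (ℕ; zero; suc; _+_; _*_; _≤_; z≤n; s≤s; s≤s⁻¹; _<ᵇ_)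
open import Data.Nat.Properties
  using (≤-refl; ≤-trans; ≤-reflexive; m≤n⇒m≤1+n; m≤m+n; m≤n+m; n≤1+n; +-assoc; +-comm; +-suc;
    +-mono-≤; +-monoʳ-≤; +-monoˡ-≤; m≤n⇒m<n∨m≡n; module ≤-Reasoning)
open import Data.Product.Base using (Σ; Σ-syntax; ∃; ∃-syntax; _×_; _,_; proj₁; proj₂)
open import Data.Sum.Base using (_⊎_; inj₁; inj₂; [_,_]′)
open import Data.Vec.Functional using () renaming (_∷_ to _∷ᶠ_)
open import Function.Base using (_∘_; id)
open import Function.Bundles using (_⇔_; mk⇔; Inverse)
open import Function.Definitions using (Injective)
open import Function.Properties.Inverse using (↔⇒↣; ↔-sym)
open import Level using (Level)
open import Relation.Binary.Definitions using (DecidableEquality)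
open import Relation.Binary.PropositionalEquality as ≡
  using (_≡_; _≢_; refl; sym; trans; cong; cong₂; subst; module ≡-Reasoning)
open import Relation.Nullary using (¬_; Dec; yes; no; contradiction)
open import Relation.Nullary.Decidable using (map′; ¬?; _×-dec_; _⊎-dec_; decidable-stable)
open Graph using (V; Adj)
open IsPath

-- Lists

module _ {A : Set} where

  last-++-[] : ∀ (xs : List A) {y} → last (xs ++ [ y ]) ≡ just y
  last-++-[] []           = refl
  last-++-[] (x ∷ [])     = refl
  last-++-[] (x ∷ y ∷ xs) = last-++-[] (y ∷ xs)

  last⇒++-[] : ∀ (xs : List A) {y} → last xs ≡ just y → ∃[ ys ] xs ≡ ys ++ [ y ]
  last⇒++-[] (x ∷ [])     refl = [] , refl
  last⇒++-[] (x ∷ z ∷ xs) eq with ys , eq′ ← last⇒++-[] (z ∷ xs) eq = x ∷ ys , cong (x ∷_) eq′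

  length-++-[] : ∀ (xs : List A) {y} → length (xs ++ [ y ]) ≡ suc (length xs)
  length-++-[] []       = refl
  length-++-[] (x ∷ xs) = cong suc (length-++-[] xs)

  reverse-∷-++-[] : ∀ (x : A) xs y → reverse (x ∷ xs ++ [ y ]) ≡ y ∷ reverse xs ++ [ x ]
  reverse-∷-++-[] x xs y = trans (unfold-reverse x (xs ++ [ y ])) (cong (_++ [ x ]) (reverse-++ xs [ y ]))

  unique-∷ : ∀ {x : A} {xs} → x ∉ xs → Unique xs → Unique (x ∷ xs)
  unique-∷ x∉xs xs! = ¬Any⇒All¬ _ x∉xs ∷ xs!

  unique-∷⁻ : ∀ {x : A} {xs} → Unique (x ∷ xs) → Unique xs
  unique-∷⁻ (_ ∷ xs!) = xs!

  unique-++-[] : ∀ {xs : List A} {y} → Unique xs → y ∉ xs → Unique (xs ++ [ y ])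
  unique-++-[] xs! y∉xs = Unique.++⁺ xs! ([] ∷ []) λ { (x∈xs , here refl) → y∉xs x∈xs }

  unique-reverse : ∀ {xs : List A} → Unique xs → Unique (reverse xs)
  unique-reverse []                     = []
  unique-reverse {x ∷ xs} (x∉xs ∷ xs!) = subst Unique (sym (unfold-reverse x xs))
    (unique-++-[] (unique-reverse xs!) (All¬⇒¬Any x∉xs ∘ reverse⁻))

  unique-++-[]⇒∉ : ∀ (xs : List A) {y} → Unique (xs ++ [ y ]) → y ∉ xs
  unique-++-[]⇒∉ (x ∷ xs) (x∉ ∷ _)  (here refl) = All¬⇒¬Any x∉ (∈-++⁺ʳ xs (here refl))
  unique-++-[]⇒∉ (x ∷ xs) (_ ∷ xs!) (there y∈)  = unique-++-[]⇒∉ xs xs! y∈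

  -- The shape of the condition in `covers-Adj`, so that adjacency in a subdivision can be defined
  -- by it.
  Consecutive : List A → A → A → Set
  Consecutive zs x y = ∃[ xs ] ∃[ ys ] zs ≡ xs ++ x ∷ y ∷ ys

  consecutive-linked : ∀ zs → Linked (Consecutive zs) zs
  consecutive-linked []           = []
  consecutive-linked (x ∷ [])     = [-]
  consecutive-linked (x ∷ y ∷ zs) = ([] , zs , refl) ∷
    Linked.map (λ { (xs , ys , eq) → x ∷ xs , ys , cong (x ∷_) eq }) (consecutive-linked (y ∷ zs))

  consecutive-reverse : ∀ {zs x y} → Consecutive zs x y → Consecutive (reverse zs) y x
  consecutive-reverse {x = x} {y} (xs , ys , refl) = reverse ys , reverse xs , (begin
    reverse (xs ++ x ∷ y ∷ ys)                 ≡⟨ reverse-++ xs (x ∷ y ∷ ys) ⟩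
    reverse (x ∷ y ∷ ys) ++ reverse xs         ≡⟨ cong (_++ reverse xs) (reverse-++ (x ∷ [ y ]) ys) ⟩
    (reverse ys ++ y ∷ [ x ]) ++ reverse xs    ≡⟨ ++-assoc (reverse ys) (y ∷ [ x ]) (reverse xs) ⟩
    reverse ys ++ y ∷ x ∷ reverse xs           ∎)
    where open ≡-Reasoning

  linked⇒consecutive : ∀ {R : A → A → Set} {zs x y} → Linked R zs → Consecutive zs x y → R x y
  linked⇒consecutive (xRy ∷ _) ([] , _ , refl)               = xRy
  linked⇒consecutive (_ ∷ l)   (_ ∷ [] , ys , refl)          = linked⇒consecutive l ([] , ys , refl)
  linked⇒consecutive (_ ∷ l)   (_ ∷ xs@(_ ∷ _) , ys , refl)  = linked⇒consecutive l (xs , ys , refl)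

  map-proj₁-toList : ∀ {P : A → Set} {xs} (pxs : All P xs) → map proj₁ (All.toList pxs) ≡ xs
  map-proj₁-toList []        = refl
  map-proj₁-toList (_ ∷ pxs) = cong (_ ∷_) (map-proj₁-toList pxs)

  meet? : DecidableEquality A → ∀ xs ys → Dec (Any (_∈ ys) xs)
  meet? _≟_ xs ys = Any.any? (λ x → Any.any? (x ≟_) ys) xs

  -- If all `suc m` lists met `S`, a chosen common entry of each would give an index into `S`. By
  -- pigeonhole two indices agree, so one vertex lies in two of the lists.
  disjoint-lists-escape : DecidableEquality A → ∀ {m} (S : List A) → length S ≤ m →
    (L : Fin (suc m) → List A) → (∀ {c c′ x} → x ∈ L c → x ∈ L c′ → c ≡ c′) →
    ∃[ c ] (∀ {x} → x ∈ L c → x ∉ S)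
  disjoint-lists-escape _≟_ {m} S S≤m L disjoint with any? (λ c → ¬? (meet? _≟_ (L c) S))
  ... | yes (c , avoids) = c , λ x∈L x∈S → avoids (lose x∈L x∈S)
  ... | no  all-meet     = contradiction (pigeonhole (s≤s S≤m) (Any.index ∘ hit∈S)) no-collision
    where
    meets : ∀ c → ∃[ x ] (x ∈ L c × x ∈ S)
    meets c = find (decidable-stable (meet? _≟_ (L c) S) λ avoids → all-meet (c , avoids))
    hit : Fin (suc m) → A
    hit c = proj₁ (meets c)
    hit∈L : ∀ c → hit c ∈ L c
    hit∈L c = proj₁ (proj₂ (meets c))
    hit∈S : ∀ c → hit c ∈ S
    hit∈S c = proj₂ (proj₂ (meets c))
    no-collision : ¬ (∃[ c ] ∃[ c′ ] (c < c′ × Any.index (hit∈S c) ≡ Any.index (hit∈S c′)))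
    no-collision (c , c′ , c<c′ , eq) = <⇒≢ c<c′ (disjoint (hit∈L c) (subst (_∈ L c′) (sym same) (hit∈L c′)))
      where
      same : hit c ≡ hit c′
      same = trans (lookup-index (hit∈S c)) (trans (cong (lookup S) eq) (sym (lookup-index (hit∈S c′))))

-- Proofs of x ∉ S are definitionally equal, because the library's ⊥ is proof-irrelevant.
proj₁-∉-injective : ∀ {A : Set} {S : List A} → Injective _≡_ _≡_ (proj₁ {B = _∉ S})
proj₁-∉-injective refl = refl

-- Ranks are decidable

-- Finiteness is used in this form because it passes to lists of bounded length and to complements
-- of lists. That covers the quantifiers over deletion sets, paths and vertices in the definition of
-- rank.
Searchable : Set → Set₁
Searchable A = ∀ {P : A → Set} → (∀ a → Dec (P a)) → Dec (∃ P)

searchable-lists : ∀ {A} → Searchable A → ∀ n {P : List A → Set} → (∀ l → Dec (P l)) →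
                   Dec (∃[ l ] (length l ≤ n × P l))
searchable-lists search zero    P? = map′ (λ p → [] , z≤n , p) (λ { ([] , _ , p) → p }) (P? [])
searchable-lists search (suc n) P? = map′
  [ (λ p → [] , z≤n , p) , (λ { (a , l , le , p) → a ∷ l , s≤s le , p }) ]′
  (λ { ([] , _ , p) → inj₁ p ; (a ∷ l , s≤s le , p) → inj₂ (a , l , le , p) })
  (P? [] ⊎-dec search (λ a → searchable-lists search n (P? ∘ (a ∷_))))

searchable-∉ : ∀ {A} → Searchable A → DecidableEquality A → (S : List A) → Searchable (∃ (_∉ S))
searchable-∉ search _≟_ S {P} P? =
  map′ (λ { (a , a∉S , p) → (a , a∉S) , p }) (λ { ((a , a∉S) , p) → a , a∉S , p }) (search test)
  where
  test : ∀ a → Dec (Σ[ a∉S ∈ a ∉ S ] P (a , a∉S))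
  test a with Any.any? (a ≟_) S
  ... | yes a∈S = no λ { (a∉S , _) → a∉S a∈S }
  ... | no  a∉S = map′ (a∉S ,_) proj₂ (P? (a , a∉S))

module _ (G : FiniteGraph) where
  open FiniteGraph G using (enum; adj?)

  _≟ⱽ_ : DecidableEquality (Vertex G)
  _≟ⱽ_ = inj⇒≟ (↔⇒↣ (↔-sym enum))

  searchable-vertices : Searchable (Vertex G)
  searchable-vertices {P} P? = map′
    (λ { (i , p) → Inverse.to enum i , p })
    (λ { (v , p) → Inverse.from enum v , subst P (sym (Inverse.strictlyInverseˡ enum v)) p })
    (any? (P? ∘ Inverse.to enum))

  _≟⁻_ : ∀ {S} → DecidableEquality (V (graph G − S))
  x ≟⁻ y = map′ proj₁-∉-injective (cong proj₁) (proj₁ x ≟ⱽ proj₁ y)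

  inBall? : ∀ {S} r v x → Dec (InBall (graph G − S) r v x)
  -- At most `r` edges means at most `r + 1` vertices, so only finitely many lists are candidates.
  inBall? {S} r v x = map′ (λ { (p , le , path) → p , path , le }) (λ { (p , path , le) → p , le , path })
    (searchable-lists (searchable-∉ searchable-vertices _≟ⱽ_ S) (suc r) isPath?)
    where
    isPath? : ∀ p → Dec (IsPath (graph G − S) v x p)
    isPath? p = map′
      (λ { (s , e , l , u) → record { starts = s ; ends = e ; linked = l ; unique = u } })
      (λ q → starts q , ends q , linked q , unique q)
      (Maybe.≡-dec _≟⁻_ _ _ ×-dec Maybe.≡-dec _≟⁻_ _ _ ×-dec
       linked? (λ y z → adj? (proj₁ y) (proj₁ z)) p ×-dec allPairs? (λ y z → ¬? (y ≟⁻ z)) p)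

  module _ (r m : ℕ) where
    open Rank (graph G) r m

    Unranked-neighbour : (Vertex G → Set) → ∀ {v} S → v ∉ S → Set
    Unranked-neighbour R {v} S v∉S =
      ∃[ x ] (InBall (graph G − S) r (v , v∉S) x × x ≢ (v , v∉S) × ¬ R (proj₁ x))

    module _ {R : Vertex G → Set} (R? : ∀ v → Dec (R v)) where

      unranked-neighbour? : ∀ {v} S (v∉S : v ∉ S) → Dec (Unranked-neighbour R S v∉S)
      unranked-neighbour? {v} S v∉S = searchable-∉ searchable-vertices _≟ⱽ_ S
        (λ x → inBall? r (v , v∉S) x ×-dec ¬? (x ≟⁻ (v , v∉S)) ×-dec ¬? (R? (proj₁ x)))

      all-ranked : ∀ {v} S (v∉S : v ∉ S) → ¬ Unranked-neighbour R S v∉S →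
                   ∀ x → InBall (graph G − S) r (v , v∉S) x → x ≢ (v , v∉S) → R (proj₁ x)
      all-ranked S v∉S none x ball x≢v = decidable-stable (R? (proj₁ x)) λ ¬Rx → none (x , ball , x≢v , ¬Rx)

      eligible? : ∀ v → Dec (Eligible R v)
      eligible? v = map′
        (λ { (S , le , v∉S , none) → S , v∉S , le , all-ranked S v∉S none })
        (λ { (S , v∉S , le , all) → S , le , v∉S , λ { (x , ball , x≢v , ¬Rx) → ¬Rx (all x ball x≢v) } })
        (searchable-lists searchable-vertices m test)
        where
        test : ∀ S → Dec (Σ[ v∉S ∈ v ∉ S ] ¬ Unranked-neighbour R S v∉S)
        test S with Any.any? (v ≟ⱽ_) S
        ... | yes v∈S = no λ { (v∉S , _) → v∉S v∈S }
        ... | no  v∉S = map′ (v∉S ,_) proj₂ (¬? (unranked-neighbour? S v∉S))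

      -- Decidability turns the bare negation of `Eligible` into an actual vertex for the greedy
      -- construction to go to.
      ineligible⇒unranked-neighbour : ∀ {v} → ¬ Eligible R v → ∀ S (v∉S : v ∉ S) → length S ≤ m →
                                      Unranked-neighbour R S v∉S
      ineligible⇒unranked-neighbour ¬el S v∉S le = decidable-stable (unranked-neighbour? S v∉S)
        λ none → ¬el (S , v∉S , le , all-ranked S v∉S none)

    rankedWithin? : ∀ i v → Dec (RankedWithin i v)
    rankedWithin? zero    v = no λ ()
    rankedWithin? (suc i) v = rankedWithin? i v ⊎-dec (¬? (rankedWithin? i v) ×-dec eligible? (rankedWithin? i) v)

-- Ranks and the number of rounds

module _ {G : Graph} {r m : ℕ} where
  open Rank G r m using (Eligible; HasRank; RankedWithin)

  rankedWithin-mono : ∀ {i j v} → i ≤ j → RankedWithin i v → RankedWithin j v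
  rankedWithin-mono {zero}          _          ()
  rankedWithin-mono {suc i} {suc j} i≤j        ranked with m≤n⇒m<n∨m≡n i≤j
  ... | inj₁ i<j  = inj₁ (rankedWithin-mono (s≤s⁻¹ i<j) ranked)
  ... | inj₂ refl = ranked

  rankAtMost⇒rankedWithin : ∀ {d v} → RankAtMost G r m d v → RankedWithin d v
  rankAtMost⇒rankedWithin (suc i , i≤d , has) = rankedWithin-mono i≤d (inj₂ has)

  rankedWithin⇒rankAtMost : ∀ {d v} → RankedWithin d v → RankAtMost G r m d v
  rankedWithin⇒rankAtMost {suc d} (inj₂ has) = suc d , ≤-refl , has
  rankedWithin⇒rankAtMost {suc d} (inj₁ ranked)
    with i , i≤d , has ← rankedWithin⇒rankAtMost ranked = i , m≤n⇒m≤1+n i≤d , has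

  -- The set that served in an earlier round still serves, since the ranked vertices only increase.
  rankedWithin⇒eligible : ∀ {i v} → RankedWithin (suc i) v → Eligible (RankedWithin i) v
  rankedWithin⇒eligible {i}     (inj₂ (_ , el)) = el
  rankedWithin⇒eligible {suc i} (inj₁ ranked)
    with S , v∉S , le , all ← rankedWithin⇒eligible ranked =
    S , v∉S , le , λ x ball x≢v → inj₁ (all x ball x≢v)

-- Subdivided trees force large rank

module _ {m d : ℕ} where

  below-injective : ∀ {c} {u w : Node m d} → below c u ≡ below c w → u ≡ w
  below-injective refl = refl

  below-root-injective : ∀ {c c′} → below {d = d} c root ≡ below {m} c′ root → c ≡ c′
  below-root-injective refl = refl

  root≢below : ∀ {c} {u : Node m d} → root ≢ below c u
  root≢below ()

module _ {G : FiniteGraph} {r m d : ℕ} {K : Graph}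
         (sub : IsSubdivision r (T d (suc m)) K) (K⊆G : K IsContainedIn graph G) where
  open IsSubdivision sub
  open _IsContainedIn_ K⊆G renaming (map to embed)
  open Rank (graph G) (suc r) m

  private
    Tree = T d (suc m)

    -- The start `branch u` is left out: it is common to all paths from `u`, and a deletion set for
    -- `embed (branch u)` does not contain it.
    arm : V Tree → V Tree → List (V K)
    arm u w = inner u w ++ [ branch w ]

    arm-disjoint : ∀ {u w w′ x} → Adj Tree u w → Adj Tree u w′ → x ∈ arm u w → x ∈ arm u w′ → w ≡ w′
    arm-disjoint {u} {w} {w′} e e′ x∈ x∈′ with ∈-++⁻ (inner u w) x∈ | ∈-++⁻ (inner u w′) x∈′
    ... | inj₁ i           | inj₂ (here refl) = contradiction i (inner-new e _)
    ... | inj₂ (here refl) | inj₁ i           = contradiction i (inner-new e′ _)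
    ... | inj₂ (here refl) | inj₂ (here eq)   = branch-injective eq
    ... | inj₁ i           | inj₁ i′ with inner-disjoint e e′ i i′
    ...   | inj₁ (_ , eq)    = eq
    ...   | inj₂ (refl , eq) = eq

    -- At most `r` internal vertices give at most `r + 1` edges, whence the radius `suc r`. Pairing
    -- each vertex with its proof of avoiding `S` moves the path into `graph G − S`; its properties
    -- are reflected along `proj₁`.
    path-in-ball : ∀ {u w S} → Adj Tree u w → (u∉ : embed (branch u) ∉ S) → (∀ {x} → x ∈ map embed (arm u w) → x ∉ S) →
                   Σ[ w∉ ∈ embed (branch w) ∉ S ]
                   InBall (graph G − S) (suc r) (embed (branch u) , u∉) (embed (branch w) , w∉)
    path-in-ball {u} {w} {S} e u∉ avoids = w∉ , p , record
      { starts = refl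
      ; ends   = p-ends
      ; linked = Linked.map⁻ (subst (Linked (Adj (graph G))) (sym p≡)
                   (Linked.map⁺ (Linked.map map-Adj (linked (path-isPath e)))))
      ; unique = Unique.map⁻ (subst Unique (sym p≡) (Unique.map⁺ map-injective (unique (path-isPath e))))
      } , p-length
      where
      w∉ : embed (branch w) ∉ S
      w∉ = avoids (∈-map⁺ embed (∈-++⁺ʳ (inner u w) (here refl)))
      all : All (_∉ S) (map embed (path u w))
      all = u∉ ∷ All.tabulate avoids
      p = All.toList all
      p≡ : map proj₁ p ≡ map embed (path u w)
      p≡ = map-proj₁-toList all
      p-ends : last p ≡ just (embed (branch w) , w∉)
      p-ends = Maybe.map-injective proj₁-∉-injective (begin
        Maybe.map proj₁ (last p)           ≡⟨ sym (last-map proj₁ p) ⟩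
        last (map proj₁ p)                 ≡⟨ cong last p≡ ⟩
        last (map embed (path u w))        ≡⟨ last-map embed (path u w) ⟩
        Maybe.map embed (last (path u w))  ≡⟨ cong (Maybe.map embed) (ends (path-isPath e)) ⟩
        just (embed (branch w))            ∎)
        where open ≡-Reasoning
      p-length : length p ≤ suc (suc r)
      p-length = begin
        length p                       ≡⟨ sym (length-map proj₁ p) ⟩
        length (map proj₁ p)           ≡⟨ cong length p≡ ⟩
        length (map embed (path u w))  ≡⟨ length-map embed (path u w) ⟩
        length (path u w)              ≡⟨ cong suc (length-++-[] (inner u w)) ⟩
        suc (suc (length (inner u w))) ≤⟨ s≤s (s≤s (inner-length e)) ⟩
        suc (suc r)                    ∎
        where open ≤-Reasoning

    arm-image-disjoint : ∀ {u w w′ x} → Adj Tree u w → Adj Tree u w′ →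
                         x ∈ map embed (arm u w) → x ∈ map embed (arm u w′) → w ≡ w′
    arm-image-disjoint e e′ x∈ x∈′ with ∈-map⁻ embed x∈ | ∈-map⁻ embed x∈′
    ... | y , y∈ , refl | y′ , y∈′ , eq =
      arm-disjoint e e′ y∈ (subst (_∈ _) (sym (map-injective eq)) y∈′)

  -- f embeds T_{i,m+1} as the tree hanging from the node f root.
  subtree-root-unranked : ∀ i (f : Node (suc m) i → Node (suc m) d) → Injective _≡_ _≡_ f →
    (∀ {u w} → IsParent u w → IsParent (f u) (f w)) → ¬ RankedWithin i (embed (branch (f root)))
  -- For `i = 0` nothing is to be refuted, as no vertex is ranked within zero rounds.
  subtree-root-unranked (suc i) f f-inj f-parent ranked
    with S , v∉S , S≤m , all ← rankedWithin⇒eligible {r = suc r} {m = m} {i = i} ranked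
    with c , avoids ← disjoint-lists-escape (_≟ⱽ_ G) S S≤m (λ c → map embed (arm (f root) (f (below c root))))
           (λ x∈ x∈′ → below-root-injective (f-inj
             (arm-image-disjoint (inj₁ (f-parent (here _))) (inj₁ (f-parent (here _))) x∈ x∈′)))
    with w∉S , ball ← path-in-ball (inj₁ (f-parent (here c))) v∉S avoids
    -- The spared child lies in the ball and differs from the root, so it would be ranked within `i`
    -- rounds, against the induction hypothesis for its own subtree.
    = subtree-root-unranked i (f ∘ below c) (λ eq → below-injective (f-inj eq)) (f-parent ∘ there c)
        (all _ ball λ eq → root≢below (f-inj (branch-injective (map-injective (sym (cong proj₁ eq))))))

-- Subdivided trees in a graph

depth : ∀ {m d} → Node m d → ℕ
depth root        = 0
depth (below _ u) = suc (depth u)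

parent-depth : ∀ {m d} {u w : Node m d} → IsParent u w → depth w ≡ suc (depth u)
parent-depth (here c)    = refl
parent-depth (there c e) = cong suc (parent-depth e)

parent-unique : ∀ {m d} {u u′ w : Node m d} → IsParent u w → IsParent u′ w → u ≡ u′
parent-unique (here c)    (here .c)     = refl
parent-unique (there c e) (there .c e′) = cong (below c) (parent-unique e e′)

parent-of : ∀ {m d} c (w : Node m d) → ∃[ u ] IsParent u (below c w)
parent-of c root         = root , here c
parent-of c (below c′ w) with u , e ← parent-of c′ w = below c u , there c e

n<ᵇ1+n : ∀ n → (n <ᵇ suc n) ≡ true
n<ᵇ1+n zero    = refl
n<ᵇ1+n (suc n) = n<ᵇ1+n n

1+n≮ᵇn : ∀ n → (suc n <ᵇ n) ≡ false
1+n≮ᵇn zero    = refl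
1+n≮ᵇn (suc n) = 1+n≮ᵇn n

-- A ≤r-subdivision of T_{d,m} inside G, with one extra path `up root` leading
-- to the root: `up w` lists the internal vertices on the way down to `branch w`
-- from its parent, or from the start of the extra path when w is the root.
record PlantedTree (G : Graph) (r m d : ℕ) : Set where
  field
    branch : Node m d → V G
    up     : Node m d → List (V G)

  -- Each vertex of the tree lies in the segment of exactly one node, so `seg-disjoint` and
  -- `seg-unique` together express every disjointness condition of a subdivision.
  seg : Node m d → List (V G)
  seg w = up w ++ [ branch w ]

  field
    up-length    : ∀ w → length (up w) ≤ r
    seg-linked   : ∀ {u w} → IsParent u w → Linked (Adj G) (branch u ∷ seg w)
    seg-unique   : ∀ w → Unique (seg w)
    seg-disjoint : ∀ {w w′ x} → x ∈ seg w → x ∈ seg w′ → w ≡ w′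

  branch∈seg : ∀ w → branch w ∈ seg w
  branch∈seg w = ∈-++⁺ʳ (up w) (here refl)

open PlantedTree

-- From a planted tree with empty stem to a shallow topological minor

module _ {G : Graph} {r m d : ℕ} (P : PlantedTree G r m d) (no-stem : up P root ≡ []) where

  private
    -- Each vertex is tagged with its node and its place in the segment. Segments are disjoint and
    -- free of repetitions, so the vertex determines both tags.
    VK : Set
    VK = Σ[ w ∈ Node m d ] Σ[ x ∈ V G ] x ∈ seg P w

    vertex : VK → V G
    vertex (_ , x , _) = x

    vertex-injective : Injective _≡_ _≡_ vertex
    vertex-injective {w , x , i} {w′ , .x , i′} refl with refl ← seg-disjoint P i i′ =
      cong (λ i → w , x , i) (unique⇒irrelevant (≡.setoid _) (λ { refl refl → refl }) (seg-unique P w) i i′)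

    branchK : Node m d → VK
    branchK w = w , branch P w , branch∈seg P w

    upK : Node m d → List VK
    upK w = mapWith∈ (up P w) (λ {x} i → w , x , ∈-++⁺ˡ i)

    vertex-upK : ∀ w → map vertex (upK w) ≡ up P w
    vertex-upK w = trans (map-mapWith∈ (up P w) _ vertex) (mapWith∈-id (up P w))

    segK : Node m d → List VK
    segK w = upK w ++ [ branchK w ]

    vertex-segK : ∀ w → map vertex (segK w) ≡ seg P w
    vertex-segK w = trans (map-++ vertex (upK w) _) (cong (_++ [ branch P w ]) (vertex-upK w))

    segK-unique : ∀ w → Unique (segK w)
    segK-unique w = Unique.map⁻ (subst Unique (sym (vertex-segK w)) (seg-unique P w))

    ∈-segK : ∀ {w x} → x ∈ segK w → vertex x ∈ seg P w
    ∈-segK {w} x∈ = subst (_ ∈_) (vertex-segK w) (∈-map⁺ vertex x∈)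

    segK-disjoint : ∀ {w w′ x} → x ∈ segK w → x ∈ segK w′ → w ≡ w′
    segK-disjoint x∈ x∈′ = seg-disjoint P (∈-segK x∈) (∈-segK x∈′)

    branchK∈segK : ∀ w → branchK w ∈ segK w
    branchK∈segK w = ∈-++⁺ʳ (upK w) (here refl)

    -- Adjacent nodes differ by one in depth, the deeper one being the child.
    innerK : Node m d → Node m d → List VK
    innerK u w = if depth u <ᵇ depth w then upK w else reverse (upK u)

    innerK-down : ∀ {u w} → IsParent u w → innerK u w ≡ upK w
    innerK-down {u} e rewrite parent-depth e | n<ᵇ1+n (depth u) = refl

    innerK-up : ∀ {u w} → IsParent w u → innerK u w ≡ reverse (upK u)
    innerK-up {w = w} e rewrite parent-depth e | 1+n≮ᵇn (depth w) = refl

    pathK : Node m d → Node m d → List VK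
    pathK u w = branchK u ∷ innerK u w ++ [ branchK w ]

    pathK-down : ∀ {u w} → IsParent u w → pathK u w ≡ branchK u ∷ segK w
    pathK-down {u} {w} e = cong (λ l → branchK u ∷ l ++ [ branchK w ]) (innerK-down e)

    _~_ : Node m d → Node m d → Set
    _~_ = Adj (T d m)

    innerK-reverse : ∀ {u w} → u ~ w → innerK w u ≡ reverse (innerK u w)
    innerK-reverse (inj₁ e) = trans (innerK-up e) (cong reverse (sym (innerK-down e)))
    innerK-reverse (inj₂ e) = trans (innerK-down e)
      (trans (sym (reverse-involutive _)) (cong reverse (sym (innerK-up e))))

    pathK-reverse : ∀ {u w} → u ~ w → pathK w u ≡ reverse (pathK u w)
    pathK-reverse {u} {w} e = trans (cong (λ l → branchK w ∷ l ++ [ branchK u ]) (innerK-reverse e))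
      (sym (reverse-∷-++-[] (branchK u) (innerK u w) (branchK w)))

    -- Only edges along the replacing paths count, as `covers-Adj` demands; other edges of `G`
    -- between these vertices are dropped.
    AdjK : VK → VK → Set
    AdjK x y = ∃[ u ] ∃[ w ] (u ~ w × Consecutive (pathK u w) x y)

    AdjK-sym : ∀ {x y} → AdjK x y → AdjK y x
    AdjK-sym (u , w , e , xy) = w , u , Graph.sym (T d m) e ,
      subst (λ l → Consecutive l _ _) (sym (pathK-reverse e)) (consecutive-reverse xy)

    pathK-down-linked : ∀ {u w} → IsParent u w → Linked (λ x y → Adj G (vertex x) (vertex y)) (pathK u w)
    pathK-down-linked {u} {w} e = Linked.map⁻ (subst (Linked (Adj G))
      (sym (trans (cong (map vertex) (pathK-down e)) (cong (branch P u ∷_) (vertex-segK w)))) (seg-linked P e))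

    vertex-Adj : ∀ {x y} → AdjK x y → Adj G (vertex x) (vertex y)
    vertex-Adj (u , w , inj₁ e , xy) = linked⇒consecutive (pathK-down-linked e) xy
    vertex-Adj (u , w , inj₂ e , xy) = Graph.sym G (linked⇒consecutive (pathK-down-linked e)
      (subst (λ l → Consecutive l _ _) (sym (pathK-reverse (inj₂ e))) (consecutive-reverse xy)))

    K : Graph
    K = record
      { V      = VK
      ; Adj    = AdjK
      ; sym    = AdjK-sym
      ; irrefl = λ { refl xx → Graph.irrefl G refl (vertex-Adj xx) }
      }

    pathK-down-unique : ∀ {u w} → IsParent u w → Unique (pathK u w)
    pathK-down-unique {u} {w} e = subst Unique (sym (pathK-down e)) (unique-∷ u∉ (segK-unique w))
      where
      u∉ : branchK u ∉ segK w
      u∉ u∈ with refl ← segK-disjoint (branchK∈segK u) u∈ = IsParent-irrefl e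

    pathK-unique : ∀ {u w} → u ~ w → Unique (pathK u w)
    pathK-unique (inj₁ e) = pathK-down-unique e
    pathK-unique (inj₂ e) = subst Unique (sym (pathK-reverse (inj₁ e))) (unique-reverse (pathK-down-unique e))

    upK-length : ∀ w → length (upK w) ≤ r
    upK-length w = subst (_≤ r) (trans (cong length (sym (vertex-upK w))) (length-map vertex (upK w))) (up-length P w)

    innerK-length : ∀ {u w} → u ~ w → length (innerK u w) ≤ r
    innerK-length {u} {w} (inj₁ e) rewrite innerK-down e = upK-length w
    innerK-length {u} {w} (inj₂ e) rewrite innerK-up e | length-reverse (upK u) = upK-length u

    lower : ∀ {u w} → u ~ w → Node m d
    lower {w = w} (inj₁ _) = w
    lower {u = u} (inj₂ _) = u

    -- A node has only one parent, so the lower end determines the edge; the alternatives tell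
    -- whether both pairs run in the same direction.
    lower-injective : ∀ {u w u′ w′} (e : u ~ w) (e′ : u′ ~ w′) → lower e ≡ lower e′ →
                      (u ≡ u′ × w ≡ w′) ⊎ (u ≡ w′ × w ≡ u′)
    lower-injective (inj₁ e) (inj₁ e′) refl = inj₁ (parent-unique e e′ , refl)
    lower-injective (inj₁ e) (inj₂ e′) refl = inj₂ (parent-unique e e′ , refl)
    lower-injective (inj₂ e) (inj₁ e′) refl = inj₂ (refl , parent-unique e e′)
    lower-injective (inj₂ e) (inj₂ e′) refl = inj₁ (refl , parent-unique e e′)

    ∈-innerK : ∀ {u w x} (e : u ~ w) → x ∈ innerK u w → x ∈ upK (lower e)
    ∈-innerK (inj₁ e) x∈ = subst (_ ∈_) (innerK-down e) x∈
    ∈-innerK (inj₂ e) x∈ = reverse⁻ (subst (_ ∈_) (innerK-up e) x∈)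

    -- Disjointness of segments would force `u` to be `w`, and then `branchK w` would occur twice in
    -- its own segment.
    branchK∉upK : ∀ u w → branchK u ∉ upK w
    branchK∉upK u w u∈ with refl ← segK-disjoint (branchK∈segK u) (∈-++⁺ˡ u∈) =
      unique-++-[]⇒∉ (upK u) (segK-unique u) u∈

    coversK : ∀ x → (∃[ w ] x ≡ branchK w) ⊎ (∃[ u ] ∃[ w ] (u ~ w × x ∈ innerK u w))
    coversK (w , x , x∈) with ∈-++⁻ (up P w) x∈
    coversK (w , x , x∈) | inj₂ (here refl) = inj₁ (w , vertex-injective refl)
    -- Internal vertices above the root would subdivide no edge of the tree; the empty stem excludes
    -- them.
    coversK (root , x , x∈) | inj₁ i = contradiction (subst (x ∈_) no-stem i) λ ()
    coversK (below c w , x , x∈) | inj₁ i with u , e ← parent-of c w =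
      inj₂ (u , below c w , inj₁ e , subst (_ ∈_) (sym (innerK-down e)) x∈upK)
      where
      x∈upK : (below c w , x , x∈) ∈ upK (below c w)
      x∈upK with y , y∈ , eq ← ∈-map⁻ vertex (subst (x ∈_) (sym (vertex-upK (below c w))) i) =
        subst (_∈ upK (below c w)) (vertex-injective (sym eq)) y∈

  planted⇒minor : ShallowTopologicalMinor r (T d m) G
  planted⇒minor = K , subdivision , record
    { map = vertex ; map-injective = vertex-injective ; map-Adj = vertex-Adj }
    where
    subdivision : IsSubdivision r (T d m) K
    subdivision = record
      { branch           = branchK
      ; branch-injective = λ eq → cong proj₁ eq
      ; inner            = innerK
      ; inner-length     = innerK-length
      ; inner-reverse    = innerK-reverse
      ; path-isPath      = λ {u} {w} e → record
          { starts = refl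
          ; ends   = last-++-[] (branchK u ∷ innerK u w)
          ; linked = Linked.map (λ xy → u , w , e , xy) (consecutive-linked (pathK u w))
          ; unique = pathK-unique e
          }
      ; inner-new        = λ e w w∈ → branchK∉upK w (lower e) (∈-innerK e w∈)
      ; inner-disjoint   = λ e e′ x∈ x∈′ → lower-injective e e′
          (segK-disjoint (∈-++⁺ˡ (∈-innerK e x∈)) (∈-++⁺ˡ (∈-innerK e′ x∈′)))
      ; covers-V         = coversK
      ; covers-Adj       = id
      }

-- Greedy construction of subdivided trees

-- Vertices used by a planted tree: at most r + 1 on the way to its root, and n planted trees below it.
capacity : (r n d : ℕ) → ℕ
capacity r n zero    = suc r
capacity r n (suc d) = suc r + n * capacity r n d

-- The stem of each child becomes the path that subdivides the edge from `v` to that child, while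
-- `p` is the stem of the new tree.
graft : ∀ {G r n d} (v : V G) (p : List (V G)) (child : Fin n → PlantedTree G r n d) →
  length p ≤ r → Unique (p ++ [ v ]) →
  (∀ c → Linked (Adj G) (v ∷ seg (child c) root)) →
  (∀ {c w x} → x ∈ seg (child c) w → x ∉ p ++ [ v ]) →
  (∀ {c c′ w w′ x} → x ∈ seg (child c) w → x ∈ seg (child c′) w′ → c ≡ c′) →
  PlantedTree G r n (suc d)
graft {G} {n = n} {d} v p child p≤r p! link fresh apart = record
  { branch       = branch′
  ; up           = up′
  ; up-length    = λ { root → p≤r ; (below c w) → up-length (child c) w }
  ; seg-linked   = λ { (here c) → link c ; (there c e) → seg-linked (child c) e }
  ; seg-unique   = λ { root → p! ; (below c w) → seg-unique (child c) w }
  ; seg-disjoint = λ {w} {w′} → disjoint w w′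
  }
  where
  branch′ : Node n (suc d) → V G
  branch′ root        = v
  branch′ (below c w) = branch (child c) w
  up′ : Node n (suc d) → List (V G)
  up′ root        = p
  up′ (below c w) = up (child c) w
  disjoint : ∀ w w′ {x} → x ∈ up′ w ++ [ branch′ w ] → x ∈ up′ w′ ++ [ branch′ w′ ] → w ≡ w′
  disjoint root        root          _  _   = refl
  disjoint root        (below c w)   x∈ x∈′ = contradiction x∈ (fresh x∈′)
  disjoint (below c w) root          x∈ x∈′ = contradiction x∈′ (fresh x∈)
  disjoint (below c w) (below c′ w′) x∈ x∈′ with refl ← apart {c} {c′} {w} {w′} x∈ x∈′ =
    cong (below c) (seg-disjoint (child c) x∈ x∈′)

module Greedy (G : FiniteGraph) (r m n : ℕ) where
  open Rank (graph G) r m using (RankedWithin)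

  cap : ℕ → ℕ
  cap = capacity r n

  -- `S` holds the vertices already taken. The list `vertices` contains all that the tree takes in
  -- addition, so that its length can be charged against `m`.
  record TreeAt (d : ℕ) (p : List (Vertex G)) (v : Vertex G) (S : List (Vertex G)) : Set where
    field
      tree      : PlantedTree (graph G) r n d
      tree-up   : up tree root ≡ p
      tree-root : branch tree root ≡ v
      vertices  : List (Vertex G)
      covers    : ∀ {w x} → x ∈ seg tree w → x ∈ vertices
      avoids    : ∀ {x} → x ∈ vertices → x ∉ S
      size      : length vertices ≤ cap d

  -- A stage in growing the subtrees at `v`, with `k` of them finished.
  record FanAt (d k : ℕ) (v : Vertex G) (S : List (Vertex G)) : Set where
    field
      child    : Fin k → PlantedTree (graph G) r n d
      link     : ∀ c → Linked (Adj (graph G)) (v ∷ seg (child c) root)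
      apart    : ∀ {c c′ w w′ x} → x ∈ seg (child c) w → x ∈ seg (child c′) w′ → c ≡ c′
      vertices : List (Vertex G)
      covers   : ∀ {c w x} → x ∈ seg (child c) w → x ∈ vertices
      avoids   : ∀ {x} → x ∈ vertices → x ∉ v ∷ S
      size     : length vertices ≤ k * cap d

  Escape : ℕ → Vertex G → List (Vertex G) → Set
  Escape d v S = ∃[ p ] ∃[ x ]
    (length p ≤ r × Linked (Adj (graph G)) (v ∷ p ++ [ x ]) × Unique (v ∷ p ++ [ x ]) ×
     (∀ {y} → y ∈ p ++ [ x ] → y ∉ S) × ¬ RankedWithin d x)

  -- A vertex not ranked within `suc d` rounds was ineligible in the last of them, so deleting `S`
  -- leaves a path to another vertex not ranked within `d` rounds.
  escape : ∀ {d v} → ¬ RankedWithin (suc d) v → ∀ S → v ∉ S → length S ≤ m → Escape d v S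
  escape {d} {v} ¬ranked S v∉S S≤m
    with ineligible⇒unranked-neighbour G r m (rankedWithin? G r m d)
           (λ el → ¬ranked (inj₂ (¬ranked ∘ inj₁ , el))) S v∉S S≤m
  -- The empty list is no path, and a single vertex would make `x` equal to `v`; hence the path has
  -- separate first and last entries.
  ... | x , ([] , path , _) , x≢v , ¬Rx = contradiction (starts path) λ ()
  ... | x , (_ ∷ [] , path , _) , x≢v , ¬Rx =
    contradiction (just-injective (trans (sym (ends path)) (starts path))) x≢v
  ... | x , (y ∷ l@(_ ∷ _) , path , le) , x≢v , ¬Rx
    with refl ← starts path
    with q , eq ← last⇒++-[] l (ends path) =
    map proj₁ q , proj₁ x , length-q ,
    subst (λ l → Linked (Adj (graph G)) (v ∷ l)) l≡ (Linked.map⁺ (linked path)) ,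
    subst (λ l → Unique (v ∷ l)) l≡ (Unique.map⁺ proj₁-∉-injective (unique path)) ,
    (λ y∈ → avoid (subst (_ ∈_) (sym l≡) y∈)) , ¬Rx
    where
    l≡ : map proj₁ l ≡ map proj₁ q ++ [ proj₁ x ]
    l≡ = trans (cong (map proj₁) eq) (map-++ proj₁ q _)
    avoid : ∀ {y} → y ∈ map proj₁ l → y ∉ S
    avoid = All.lookup (All.fromList l)
    length-q : length (map proj₁ q) ≤ r
    length-q = begin
      length (map proj₁ q)  ≡⟨ length-map proj₁ q ⟩
      length q              ≤⟨ n≤1+n _ ⟩
      suc (length q)        ≡⟨ sym (length-++-[] q) ⟩
      length (q ++ [ x ])   ≡⟨ cong length (sym eq) ⟩
      length l              ≤⟨ s≤s⁻¹ le ⟩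
      r                     ∎
      where open ≤-Reasoning

  plantFan : ∀ {d p v S} → length p ≤ r → Unique (p ++ [ v ]) → (∀ {x} → x ∈ p ++ [ v ] → x ∉ S) →
             FanAt d n v (S ++ p) → TreeAt (suc d) p v S
  plantFan {d} {p} {v} {S} p≤r p! p∩S fan = record
    { tree      = graft v p child p≤r p! link (λ {c} {w} x∈ → fresh (avoids (covers {c} {w} x∈)))
                    (λ {c} {c′} {w} {w′} → apart {c} {c′} {w} {w′})
    ; tree-up   = refl
    ; tree-root = refl
    ; vertices  = (p ++ [ v ]) ++ vertices
    ; covers    = λ { {root} x∈ → ∈-++⁺ˡ x∈ ; {below c w} x∈ → ∈-++⁺ʳ (p ++ [ v ]) (covers {c} {w} x∈) }
    ; avoids    = λ x∈ → [ p∩S , (λ i x∈S → avoids i (there (∈-++⁺ˡ x∈S))) ]′ (∈-++⁻ (p ++ [ v ]) x∈)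
    ; size      = begin
        length ((p ++ [ v ]) ++ vertices)        ≡⟨ length-++ (p ++ [ v ]) ⟩
        length (p ++ [ v ]) + length vertices    ≡⟨ cong (_+ length vertices) (length-++-[] p) ⟩
        suc (length p) + length vertices         ≤⟨ +-mono-≤ (s≤s p≤r) size ⟩
        suc r + n * cap d                        ∎
    }
    where
    open ≤-Reasoning
    open FanAt fan
    fresh : ∀ {x} → x ∉ v ∷ S ++ p → x ∉ p ++ [ v ]
    fresh x∉ x∈ = [ (λ i → x∉ (there (∈-++⁺ʳ S i))) , (λ { (here eq) → x∉ (here eq) }) ]′ (∈-++⁻ p x∈)

  addChild : ∀ {d k p x v S} (fan : FanAt d k v S) → Linked (Adj (graph G)) (v ∷ p ++ [ x ]) →
             TreeAt d p x (v ∷ FanAt.vertices fan ++ S) → FanAt d (suc k) v S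
  addChild {d} {k} {p} {x} {v} {S} fan p-linked new = record
    { child    = child
    ; link     = λ { zero → subst (λ l → Linked (Adj (graph G)) (v ∷ l)) (sym seg-root) p-linked
                   ; (suc c) → rest.link c }
    ; apart    = λ {c} {c′} → apart c c′
    ; vertices = new.vertices ++ rest.vertices
    ; covers   = λ {c} → covers c
    ; avoids   = λ y∈ → [ new-avoids , rest.avoids ]′ (∈-++⁻ new.vertices y∈)
    ; size     = ≤-trans (≤-reflexive (length-++ new.vertices)) (+-mono-≤ new.size rest.size)
    }
    where
    module rest = FanAt fan
    module new = TreeAt new
    seg-root : seg new.tree root ≡ p ++ [ x ]
    seg-root = cong₂ (λ q y → q ++ [ y ]) new.tree-up new.tree-root
    child : Fin (suc k) → PlantedTree (graph G) r n d
    child = new.tree ∷ᶠ rest.child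
    new∩rest : ∀ {c w w′ y} → y ∈ seg new.tree w → y ∉ seg (rest.child c) w′
    new∩rest y∈ y∈′ = new.avoids (new.covers y∈) (there (∈-++⁺ˡ (rest.covers y∈′)))
    apart : ∀ c c′ {w w′ y} → y ∈ seg (child c) w → y ∈ seg (child c′) w′ → c ≡ c′
    apart zero    zero     _  _   = refl
    apart zero    (suc c)  y∈ y∈′ = contradiction y∈′ (new∩rest y∈)
    apart (suc c) zero     y∈ y∈′ = contradiction y∈ (new∩rest y∈′)
    apart (suc c) (suc c′) y∈ y∈′ = cong suc (rest.apart y∈ y∈′)
    covers : ∀ c {w y} → y ∈ seg (child c) w → y ∈ new.vertices ++ rest.vertices
    covers zero    y∈ = ∈-++⁺ˡ (new.covers y∈)
    covers (suc c) y∈ = ∈-++⁺ʳ new.vertices (rest.covers y∈)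
    new-avoids : ∀ {y} → y ∈ new.vertices → y ∉ v ∷ S
    new-avoids y∈ (here eq)   = new.avoids y∈ (here eq)
    new-avoids y∈ (there y∈S) = new.avoids y∈ (there (∈-++⁺ʳ rest.vertices y∈S))

  -- The budget `length S + cap d ≤ m` keeps every deletion set that arises while the tree grows
  -- within `m` vertices. The statement is named so that fans can be built from it at depth `d`
  -- before it is proved at depth `suc d`.
  TreesAt : ℕ → Set
  TreesAt d = ∀ {p v S} → length p ≤ r → Unique (p ++ [ v ]) → (∀ {x} → x ∈ p ++ [ v ] → x ∉ S) →
              length S + cap d ≤ m → ¬ RankedWithin d v → TreeAt d p v S

  fanAt : ∀ d → TreesAt d → ∀ k {v S} → v ∉ S → suc (length S + k * cap d) ≤ m →
          ¬ RankedWithin (suc d) v → FanAt d k v S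
  fanAt d treeAt zero    v∉S room ¬ranked = record
    { child = λ () ; link = λ () ; apart = λ { {()} } ; vertices = [] ; covers = λ { {()} }
    ; avoids = λ () ; size = z≤n }
  fanAt d treeAt (suc k) {v} {S} v∉S room ¬ranked
    with rest ← fanAt d treeAt k v∉S (≤-trans (s≤s (+-monoʳ-≤ (length S) (m≤n+m _ (cap d)))) room) ¬ranked
    -- Only `F` is deleted here, as `v` must remain; the child's tree has to avoid `v` too, which
    -- the successor in `room` pays for.
    = extend (escape ¬ranked F v∉F (≤-trans (n≤1+n _) (≤-trans (m≤m+n _ (cap d)) room-new)))
    where
    open ≤-Reasoning
    open FanAt rest
    F : List (Vertex G)
    F = vertices ++ S
    v∉F : v ∉ F
    v∉F v∈ = [ (λ i → avoids i (here refl)) , v∉S ]′ (∈-++⁻ vertices v∈)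
    room-new : length (v ∷ F) + cap d ≤ m
    room-new = begin
      suc (length F + cap d)                        ≡⟨ cong (λ l → suc (l + cap d)) (length-++ vertices) ⟩
      suc (length vertices + length S + cap d)      ≤⟨ s≤s (+-monoˡ-≤ (cap d) (+-monoˡ-≤ (length S) size)) ⟩
      suc (k * cap d + length S + cap d)            ≡⟨ cong (λ l → suc (l + cap d)) (+-comm (k * cap d) (length S)) ⟩
      suc (length S + k * cap d + cap d)            ≡⟨ cong suc (+-assoc (length S) _ _) ⟩
      suc (length S + (k * cap d + cap d))          ≡⟨ cong (λ l → suc (length S + l)) (+-comm (k * cap d) (cap d)) ⟩
      suc (length S + suc k * cap d)                ≤⟨ room ⟩
      m                                             ∎
    extend : Escape d v F → FanAt d (suc k) v S
    extend (p , x , p≤r , p-linked , vp! , p∩F , ¬Rx) =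
      addChild rest p-linked (treeAt p≤r (unique-∷⁻ vp!) p∩vF room-new ¬Rx)
      where
      p∩vF : ∀ {y} → y ∈ p ++ [ x ] → y ∉ v ∷ F
      p∩vF y∈ (here refl) = Unique.Unique[x∷xs]⇒x∉xs vp! y∈
      p∩vF y∈ (there y∈F) = p∩F y∈ y∈F

  treeAt : ∀ d → TreesAt d
  treeAt zero {p} {v} p≤r p! p∩S room ¬ranked = record
    { tree = record
        { branch = λ _ → v ; up = λ _ → p ; up-length = λ _ → p≤r ; seg-linked = λ ()
        ; seg-unique = λ _ → p! ; seg-disjoint = λ { {root} {root} _ _ → refl } }
    ; tree-up = refl ; tree-root = refl ; vertices = p ++ [ v ] ; covers = id ; avoids = p∩S
    ; size = ≤-trans (≤-reflexive (length-++-[] p)) (s≤s p≤r)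
    }
  treeAt (suc d) {p} {v} {S} p≤r p! p∩S room ¬ranked =
    -- The stem `p` joins the taken vertices. The summand `suc r` of `cap (suc d)` pays for it and
    -- for `v`.
    plantFan p≤r p! p∩S (fanAt d (treeAt d) n v∉S++p room-fan ¬ranked)
    where
    open ≤-Reasoning
    v∉S++p : v ∉ S ++ p
    v∉S++p v∈ = [ p∩S (∈-++⁺ʳ p (here refl)) , unique-++-[]⇒∉ p p! ]′ (∈-++⁻ S v∈)
    room-fan : suc (length (S ++ p) + n * cap d) ≤ m
    room-fan = begin
      suc (length (S ++ p) + n * cap d)         ≡⟨ cong (λ k → suc (k + n * cap d)) (length-++ S) ⟩
      suc (length S + length p + n * cap d)     ≡⟨ cong suc (+-assoc (length S) (length p) _) ⟩
      suc (length S + (length p + n * cap d))   ≡⟨ sym (+-suc (length S) _) ⟩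
      length S + (suc (length p) + n * cap d)   ≤⟨ +-monoʳ-≤ (length S) (+-monoˡ-≤ (n * cap d) (s≤s p≤r)) ⟩
      length S + cap (suc d)                    ≤⟨ room ⟩
      m                                         ∎

  unranked⇒minor : ∀ {d v} → cap d ≤ m → ¬ RankedWithin d v → ShallowTopologicalMinor r (T d n) (graph G)
  unranked⇒minor {d} cap≤m ¬ranked = planted⇒minor t.tree t.tree-up
    where module t = TreeAt (treeAt d {p = []} {S = []} z≤n ([] ∷ []) (λ _ ()) cap≤m ¬ranked)

-- The two implications and their constants

theorem1p3 : {ℓ : Level} (d : ℕ) (𝒞 : GraphClass ℓ) →
    TreeRankAtMost d 𝒞 ⇔
    (∀ (r : ℕ) → ∃[ m ] (∀ (G : FiniteGraph) → 𝒞 G → ∀ (v : Vertex G) → RankAtMost (graph G) r m d v))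
theorem1p3 d 𝒞 = mk⇔ tree-rank⇒rank rank⇒tree-rank
  where
  tree-rank⇒rank : TreeRankAtMost d 𝒞 →
    ∀ r → ∃[ m ] (∀ G → 𝒞 G → ∀ v → RankAtMost (graph G) r m d v)
  tree-rank⇒rank bounded r with n , no-minor ← bounded r =
    -- With this `m` the budget suffices for a whole tree grown from an empty stem with nothing
    -- taken yet.
    capacity r n d , λ G G∈𝒞 v → rankedWithin⇒rankAtMost
      (decidable-stable (rankedWithin? G r (capacity r n d) d v)
        λ ¬ranked → no-minor G G∈𝒞 (Greedy.unranked⇒minor G r (capacity r n d) n ≤-refl ¬ranked))

  rank⇒tree-rank : (∀ r → ∃[ m ] (∀ G → 𝒞 G → ∀ v → RankAtMost (graph G) r m d v)) → TreeRankAtMost d 𝒞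
  -- Radius `suc r` reaches across an edge subdivided by `r` vertices, and branching `suc m` exceeds
  -- the `m` deletions.
  rank⇒tree-rank bounded r with m , ranked ← bounded (suc r) =
    suc m , λ { G G∈𝒞 (K , sub , K⊆G) →
      subtree-root-unranked {G = G} sub K⊆G d id id id (rankAtMost⇒rankedWithin (ranked G G∈𝒞 _)) }
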